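{- Let $G$ be a graph with $n$ vertices and $m$ edges, with maximum degree $\triangle$ and minimum degree $\delta$. Then $$\delta^2\le \frac{HM_2(G)}{2(M_1(G)-2m)}\le \triangle^2,$$ and the equality holds if and only if $G$ is a regular graph.
   Context: Graphs are finite, without loops or multiple edges. For a vertex $u$, $d(u)$ is its degree; $\triangle$ and $\delta$ are the maximum and minimum vertex degree of $G$. For an edge $e=uv$ the edge degree is $d(e)=d(u)+d(v)$. The first Zagreb index is $M_1(G)=\sum_{v\in V(G)}d(v)^2$. The second hyper-Zagreb index is $HM_2(G)=\sum_{e\sim f}d(e)d(f)$, where the sum is over the pairs $\{e,f\}$ of adjacent edges of $G$ (edges having a common endpoint), each pair counted once. A graph is regular if every vertex has the same degree. -}

module Defs where

open import Data.Nat using (ℕ; _+_; _*_; _^_)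
open import Data.Nat.ListAction using (sum)
open import Data.Fin using (Fin)
open import Data.Fin.Properties using (_≟_; _<?_)
open import Data.List using (List; []; _∷_; _++_; map; filter; length; allFin; cartesianProduct)
open import Data.List.Extrema.Nat using (min; max)
open import Data.Product using (_×_; _,_)
open import Data.Sum using (_⊎_)
open import Relation.Binary using (Rel; Decidable; Symmetric)
open import Relation.Binary.PropositionalEquality using (_≡_)
open import Relation.Nullary using (¬_)
open import Relation.Nullary.Decidable using (_×-dec_; _⊎-dec_)
open import Level using (0ℓ)

record Graph (n : ℕ) : Set₁ where
  infix 4 _∼_ _∼?_
  field
    _∼_      : Rel (Fin n) 0ℓ
    _∼?_     : Decidable _∼_
    ∼-sym    : Symmetric _∼_
    ∼-irrefl : ∀ {u} → ¬ (u ∼ u)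

-- For a duplicate-free list: every unordered pair of distinct members, once.
pairs : ∀ {A : Set} → List A → List (A × A)
pairs []       = []
pairs (x ∷ xs) = map (x ,_) xs ++ pairs xs

ShareEndpoint : ∀ {n} → Rel (Fin n × Fin n) 0ℓ
ShareEndpoint (a , b) (c , d) = (a ≡ c ⊎ a ≡ d) ⊎ (b ≡ c ⊎ b ≡ d)

shareEndpoint? : ∀ {n} → Decidable (ShareEndpoint {n})
shareEndpoint? (a , b) (c , d) = (a ≟ c ⊎-dec a ≟ d) ⊎-dec (b ≟ c ⊎-dec b ≟ d)

module _ {n : ℕ} (G : Graph n) where
  open Graph G

  deg : Fin n → ℕ
  deg u = length (filter (u ∼?_) (allFin n))

  -- The first argument of max and min is a default that also takes part in the
  -- comparison; it is harmless here because 0 ≤ deg v < n for every vertex v.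
  maxDegree : ℕ
  maxDegree = max 0 (map deg (allFin n))

  minDegree : ℕ
  minDegree = min n (map deg (allFin n))

  -- The edge {u , v} is represented by (u , v) with u < v.
  edges : List (Fin n × Fin n)
  edges = filter (λ (u , v) → (u <? v) ×-dec (u ∼? v)) (cartesianProduct (allFin n) (allFin n))

  size : ℕ
  size = length edges

  edgeDeg : Fin n × Fin n → ℕ
  edgeDeg (u , v) = deg u + deg v

  adjacentEdgePairs : List ((Fin n × Fin n) × (Fin n × Fin n))
  adjacentEdgePairs = filter (λ (e , f) → shareEndpoint? e f) (pairs edges)

  M₁ : ℕ
  M₁ = sum (map (λ v → deg v ^ 2) (allFin n))

  HM₂ : ℕ
  HM₂ = sum (map (λ (e , f) → edgeDeg e * edgeDeg f) adjacentEdgePairs)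

  Regular : Set
  Regular = ∀ u v → deg u ≡ deg v

{-# OPTIONS --safe #-}
-- Let P be the number of adjacent edge pairs. Writing inc v e ∈ {0 , 1} for the
-- incidence of v with e, squaring Σₑ inc v e = d(v) and summing over v gives
-- M₁ = 2m + 2P, because two distinct edges have at most one common endpoint.
-- So the denominator is 4P, while HM₂ is a sum of P terms d(e)d(f), each between
-- 4δ² and 4Δ².
--
-- If HM₂ = 4Pδ², then every adjacent pair has d(e)d(f) = 4δ². For a vertex v of
-- degree ≥ 2, two edges at v satisfy d(e), d(f) ≥ d(v) + δ, whence d(v) = δ.
-- As P ≠ 0, some vertex has degree ≥ 2, so δ ≥ 2 and the argument applies to
-- every vertex.
module Submission where

open import Defs
open import Data.Bool using (if_then_else_; true; false)
open import Data.Nat using (ℕ; zero; suc; _+_; _*_; _∸_; _^_; z≤n; s≤s; NonZero; ≢-nonZero⁻¹)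
  renaming (_≤_ to _≤ⁿ_; _<_ to _<ⁿ_)
open import Data.Nat.ListAction using (sum)
open import Data.Nat.ListAction.Properties using (sum-++)
import Data.Nat.Properties as ℕₚ
open import Data.Nat.Tactic.RingSolver using (solve-∀)
open import Data.Rational using (_/_; _≤_)
import Data.Rational.Properties as ℚₚ
open import Data.Rational.Unnormalised using (mkℚᵘ; *≤*; *≡*)
import Data.Rational.Unnormalised.Properties as ℚᵘₚ
open import Data.Fin using (Fin; zero; suc) renaming (_<_ to _<ᶠ_)
open import Data.Fin.Properties using (_≟_; _<?_; <-cmp; <-asym; <⇒≢)
open import Data.List using (List; []; _∷_; _++_; map; filter; length; allFin; tabulate; cartesianProduct)
open import Data.List.Properties using (map-++; map-∘; map-tabulate; length-filter; length-tabulate)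
open import Data.List.Extrema.Nat using (v≤min⁺; max≤v⁺; min≤xs; xs≤max)
open import Data.List.Membership.Propositional using (_∈_)
open import Data.List.Membership.Propositional.Properties using (∈-filter⁺)
open import Data.List.Relation.Unary.All as All using (All; []; _∷_)
import Data.List.Relation.Unary.All.Properties as Allₚ
open import Data.List.Relation.Unary.AllPairs using (AllPairs; []; _∷_)
import Data.List.Relation.Unary.Unique.Propositional.Properties as Uniqueₚ
open import Data.Product using (_×_; _,_; proj₁; proj₂; uncurry)
open import Data.Sum using (_⊎_; inj₁; inj₂; [_,_]′)
open import Function using (_∘_; id; const; mk⇔)
open import Function.Bundles using (_⇔_)
open import Relation.Binary.Definitions using (tri<; tri≈; tri>)
open import Relation.Binary.PropositionalEquality
  using (_≡_; _≢_; refl; sym; trans; cong; cong₂; subst; subst₂; module ≡-Reasoning)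
open import Relation.Nullary using (¬_; Dec; yes; no; does; contradiction)
open import Relation.Nullary.Decidable using (_×-dec_; _⊎-dec_; does-⇔)
import Relation.Unary as Unary

private
  variable
    A B : Set
    P Q : Set

-- Indicators of decidable propositions.

𝟙 : Dec P → ℕ
𝟙 p? = if does p? then 1 else 0

𝟙-⇔ : P ⇔ Q → (p? : Dec P) (q? : Dec Q) → 𝟙 p? ≡ 𝟙 q?
𝟙-⇔ P⇔Q p? q? = cong (if_then 1 else 0) (does-⇔ P⇔Q p? q?)

𝟙-⊎ : (p? : Dec P) (q? : Dec Q) → ¬ (P × Q) → 𝟙 (p? ⊎-dec q?) ≡ 𝟙 p? + 𝟙 q?
𝟙-⊎ (yes p) (yes q) ¬pq = contradiction (p , q) ¬pq
𝟙-⊎ (yes p) (no ¬q) ¬pq = refl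
𝟙-⊎ (no ¬p) (yes q) ¬pq = refl
𝟙-⊎ (no ¬p) (no ¬q) ¬pq = refl

𝟙-idem : (p? : Dec P) → 𝟙 p? * 𝟙 p? ≡ 𝟙 p?
𝟙-idem (yes p) = refl
𝟙-idem (no ¬p) = refl

k≤1⇒k²≡k : ∀ {k} → k ≤ⁿ 1 → k ^ 2 ≡ k
k≤1⇒k²≡k z≤n       = refl
k≤1⇒k²≡k (s≤s z≤n) = refl

k²≡k⇒k≤1 : ∀ k → k ^ 2 ≡ k → k ≤ⁿ 1
k²≡k⇒k≤1 zero      eq = z≤n
k²≡k⇒k≤1 k@(suc _) eq = ℕₚ.≤-reflexive (trans (sym (ℕₚ.*-identityʳ k))
  (ℕₚ.*-cancelˡ-≡ (k * 1) 1 k (trans eq (sym (ℕₚ.*-identityʳ k)))))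

-- Finite sums over lists.

∑ : List A → (A → ℕ) → ℕ
∑ xs f = sum (map f xs)

infix 8 ∑
syntax ∑ xs (λ x → e) = ∑[ x ∈ xs ] e

module _ {f g : A → ℕ} where

  ∑-cong-All : ∀ {xs} → All (λ x → f x ≡ g x) xs → ∑ xs f ≡ ∑ xs g
  ∑-cong-All []         = refl
  ∑-cong-All (eq ∷ eqs) = cong₂ _+_ eq (∑-cong-All eqs)

  ∑-cong : ∀ xs → (∀ x → f x ≡ g x) → ∑ xs f ≡ ∑ xs g
  ∑-cong xs f≗g = ∑-cong-All (All.universal f≗g xs)

  ∑-mono : ∀ {xs} → All (λ x → f x ≤ⁿ g x) xs → ∑ xs f ≤ⁿ ∑ xs g
  ∑-mono []         = z≤n
  ∑-mono (le ∷ les) = ℕₚ.+-mono-≤ le (∑-mono les)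

  -- A deficit at the head could not be made up by the tails, which `∑-mono` orders the same way.
  -- Cancelling equal heads passes the equality on to the tails.
  ∑-≤-tight : ∀ {xs} → All (λ x → f x ≤ⁿ g x) xs → ∑ xs f ≡ ∑ xs g →
              All (λ x → f x ≡ g x) xs
  ∑-≤-tight []                    eq = []
  ∑-≤-tight {x ∷ xs} (le ∷ les) eq = fx≡gx ∷ ∑-≤-tight les ∑f≡∑g
    where
    fx≡gx : f x ≡ g x
    fx≡gx = ℕₚ.≤-antisym le (ℕₚ.+-cancelʳ-≤ (∑ xs g) (g x) (f x)
      (ℕₚ.≤-trans (ℕₚ.≤-reflexive (sym eq)) (ℕₚ.+-monoʳ-≤ (f x) (∑-mono les))))
    ∑f≡∑g : ∑ xs f ≡ ∑ xs g
    ∑f≡∑g = ℕₚ.+-cancelˡ-≡ (f x) _ _ (trans eq (cong (_+ ∑ xs g) (sym fx≡gx)))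

∑-const : ∀ (xs : List A) c → ∑ xs (const c) ≡ length xs * c
∑-const []       c = refl
∑-const (x ∷ xs) c = cong (c +_) (∑-const xs c)

∑-+ : ∀ (xs : List A) (f g : A → ℕ) → ∑[ x ∈ xs ] (f x + g x) ≡ ∑ xs f + ∑ xs g
∑-+ []       f g = refl
∑-+ (x ∷ xs) f g = begin
  f x + g x + ∑[ x ∈ xs ] (f x + g x) ≡⟨ cong (_ +_) (∑-+ xs f g) ⟩
  f x + g x + (∑ xs f + ∑ xs g)       ≡⟨ +-interchange (f x) (g x) (∑ xs f) (∑ xs g) ⟩
  f x + ∑ xs f + (g x + ∑ xs g)       ∎
  where
  open ≡-Reasoning
  +-interchange : ∀ a b c d → a + b + (c + d) ≡ a + c + (b + d)
  +-interchange = solve-∀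

∑-*ˡ : ∀ c (xs : List A) (f : A → ℕ) → ∑[ x ∈ xs ] (c * f x) ≡ c * ∑ xs f
∑-*ˡ c []       f = sym (ℕₚ.*-zeroʳ c)
∑-*ˡ c (x ∷ xs) f = trans (cong (c * f x +_) (∑-*ˡ c xs f)) (sym (ℕₚ.*-distribˡ-+ c _ _))

∑-swap : ∀ (xs : List A) (ys : List B) (f : A → B → ℕ) →
         ∑[ x ∈ xs ] ∑[ y ∈ ys ] f x y ≡ ∑[ y ∈ ys ] ∑[ x ∈ xs ] f x y
∑-swap []       ys f = sym (trans (∑-const ys 0) (ℕₚ.*-zeroʳ (length ys)))
∑-swap (x ∷ xs) ys f = trans (cong (∑ ys (f x) +_) (∑-swap xs ys f)) (sym (∑-+ ys _ _))

∑-++ : ∀ (xs ys : List A) (f : A → ℕ) → ∑ (xs ++ ys) f ≡ ∑ xs f + ∑ ys f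
∑-++ xs ys f = trans (cong sum (map-++ f xs ys)) (sum-++ (map f xs) (map f ys))

∑-map : ∀ (h : A → B) xs (f : B → ℕ) → ∑ (map h xs) f ≡ ∑ xs (f ∘ h)
∑-map h xs f = cong sum (sym (map-∘ xs))

∑-cartesianProduct : ∀ (xs : List A) (ys : List B) (f : A × B → ℕ) →
                     ∑ (cartesianProduct xs ys) f ≡ ∑[ x ∈ xs ] ∑[ y ∈ ys ] f (x , y)
∑-cartesianProduct []       ys f = refl
∑-cartesianProduct (x ∷ xs) ys f =
  trans (∑-++ (map (x ,_) ys) _ f)
        (cong₂ _+_ (∑-map (x ,_) ys f) (∑-cartesianProduct xs ys f))

module _ {P : A → Set} (P? : Unary.Decidable P) where

  ∑-filter : ∀ xs (f : A → ℕ) → ∑ (filter P? xs) f ≡ ∑[ x ∈ xs ] (𝟙 (P? x) * f x)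
  ∑-filter []       f = refl
  ∑-filter (x ∷ xs) f with does (P? x)
  ... | true  = cong₂ _+_ (sym (ℕₚ.+-identityʳ (f x))) (∑-filter xs f)
  ... | false = ∑-filter xs f

  length-filter≡∑ : ∀ xs → length (filter P? xs) ≡ ∑[ x ∈ xs ] 𝟙 (P? x)
  length-filter≡∑ []       = refl
  length-filter≡∑ (x ∷ xs) with does (P? x)
  ... | true  = cong suc (length-filter≡∑ xs)
  ... | false = length-filter≡∑ xs

-- Adding a head `x` to a list with sum `s` creates the cross term `2 * (f x * s)`, and `f x * s` is
-- the sum over exactly those pairs that `pairs` forms with `x` in front.
∑-square : ∀ (xs : List A) (f : A → ℕ) →
           ∑ xs f * ∑ xs f ≡ ∑[ x ∈ xs ] (f x * f x) + 2 * ∑ (pairs xs) (λ (x , y) → f x * f y)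
∑-square []       f = refl
∑-square (x ∷ xs) f = begin
  (f x + s) * (f x + s)                  ≡⟨ expand (f x) s ⟩
  f x * f x + (s * s + 2 * (f x * s))    ≡⟨ cong (λ t → f x * f x + (t + 2 * (f x * s))) (∑-square xs f) ⟩
  f x * f x + (q + 2 * r + 2 * (f x * s)) ≡⟨ regroup (f x * f x) q r (f x * s) ⟩
  f x * f x + q + 2 * (f x * s + r)      ≡⟨ cong (λ t → f x * f x + q + 2 * (t + r)) (sym (trans (∑-map (x ,_) xs g) (∑-*ˡ (f x) xs f))) ⟩
  f x * f x + q + 2 * (∑ (map (x ,_) xs) g + r) ≡⟨ cong (λ t → f x * f x + q + 2 * t) (sym (∑-++ (map (x ,_) xs) (pairs xs) g)) ⟩
  f x * f x + q + 2 * ∑ (pairs (x ∷ xs)) g ∎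
  where
  open ≡-Reasoning
  g : _ × _ → ℕ
  g (x , y) = f x * f y
  s = ∑ xs f
  q = ∑[ x ∈ xs ] (f x * f x)
  r = ∑ (pairs xs) g
  expand : ∀ a s → (a + s) * (a + s) ≡ a * a + (s * s + 2 * (a * s))
  expand = solve-∀
  regroup : ∀ a q r t → a + (q + 2 * r + 2 * t) ≡ a + q + 2 * (t + r)
  regroup = solve-∀

∑-allFin-suc : ∀ {n} (f : Fin (suc n) → ℕ) → ∑ (allFin (suc n)) f ≡ f zero + ∑ (allFin n) (f ∘ suc)
∑-allFin-suc {n} f = cong (λ ys → f zero + sum ys)
  (trans (map-tabulate suc f) (sym (map-tabulate id (f ∘ suc))))

∑-δ : ∀ {n} (v : Fin n) (f : Fin n → ℕ) → ∑[ w ∈ allFin n ] (𝟙 (v ≟ w) * f w) ≡ f v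
∑-δ {suc n} zero f = begin
  ∑ (allFin (suc n)) (λ w → 𝟙 (zero ≟ w) * f w) ≡⟨ ∑-allFin-suc (λ w → 𝟙 (zero ≟ w) * f w) ⟩
  -- `1 * f zero` reduces to `f zero + 0`, and `zero ≟ suc w` decides to `no` by computation, so
  -- every later term is already zero.
  f zero + 0 + ∑ (allFin n) (const 0)           ≡⟨ cong (f zero + 0 +_) (∑-const (allFin n) 0) ⟩
  f zero + 0 + length (allFin n) * 0            ≡⟨ cong₂ _+_ (ℕₚ.+-identityʳ (f zero)) (ℕₚ.*-zeroʳ (length (allFin n))) ⟩
  f zero + 0                                    ≡⟨ ℕₚ.+-identityʳ (f zero) ⟩
  f zero                                        ∎
  where open ≡-Reasoning
-- The term at `zero` computes to zero, and the indicator of `suc v ≟ suc w` reduces to that of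
-- `v ≟ w`.
∑-δ {suc n} (suc v) f = trans (∑-allFin-suc (λ w → 𝟙 (suc v ≟ w) * f w)) (∑-δ v (f ∘ suc))

∑-δ′ : ∀ {n} (v : Fin n) (f : Fin n → ℕ) → ∑[ w ∈ allFin n ] (𝟙 (w ≟ v) * f w) ≡ f v
∑-δ′ {n} v f = trans
  (∑-cong (allFin n) (λ w → cong (_* f w) (𝟙-⇔ (mk⇔ sym sym) (w ≟ v) (v ≟ w))))
  (∑-δ v f)

pairs⁺ : ∀ {R : A → A → Set} {xs} → AllPairs R xs → All (uncurry R) (pairs xs)
pairs⁺ []         = []
pairs⁺ (rx ∷ rxs) = Allₚ.++⁺ (Allₚ.map⁺ rx) (pairs⁺ rxs)

AllPairs-zip : ∀ {R : A → A → Set} {P : A → Set} {xs} → All P xs → AllPairs R xs →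
               AllPairs (λ x y → R x y × P x × P y) xs
AllPairs-zip []         []         = []
AllPairs-zip (px ∷ pxs) (rx ∷ rxs) =
  All.zipWith (λ (r , py) → r , px , py) (rx , pxs) ∷ AllPairs-zip pxs rxs

-- Incidence of vertices and edges.

-- A sum of two indicators, rather than the indicator of a disjunction, lets sums split by
-- linearity. Its values are 0 and 1 as soon as the two ends differ.
inc : ∀ {n} → Fin n → Fin n × Fin n → ℕ
inc v (a , b) = 𝟙 (v ≟ a) + 𝟙 (v ≟ b)

-- Serves two counts: `g = const 1` gives the two ends of an edge, and `g v = inc v f` gives the
-- common endpoints of `e` and `f`.
∑-inc : ∀ {n} (e : Fin n × Fin n) (g : Fin n → ℕ) →
        ∑[ v ∈ allFin n ] (inc v e * g v) ≡ g (proj₁ e) + g (proj₂ e)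
∑-inc {n} (a , b) g = begin
  ∑[ v ∈ allFin n ] (inc v (a , b) * g v)
    ≡⟨ ∑-cong (allFin n) (λ v → ℕₚ.*-distribʳ-+ (g v) (𝟙 (v ≟ a)) (𝟙 (v ≟ b))) ⟩
  ∑[ v ∈ allFin n ] (𝟙 (v ≟ a) * g v + 𝟙 (v ≟ b) * g v)
    ≡⟨ ∑-+ (allFin n) (λ v → 𝟙 (v ≟ a) * g v) (λ v → 𝟙 (v ≟ b) * g v) ⟩
  ∑[ v ∈ allFin n ] (𝟙 (v ≟ a) * g v) + ∑[ v ∈ allFin n ] (𝟙 (v ≟ b) * g v)
    ≡⟨ cong₂ _+_ (∑-δ′ a g) (∑-δ′ b g) ⟩
  g a + g b ∎
  where open ≡-Reasoning

inc-idem : ∀ {n} (v : Fin n) {a b} → a <ᶠ b → inc v (a , b) * inc v (a , b) ≡ inc v (a , b)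
inc-idem v {a} {b} a<b = subst (λ t → t * t ≡ t)
  (𝟙-⊎ (v ≟ a) (v ≟ b) λ (v≡a , v≡b) → <⇒≢ a<b (trans (sym v≡a) v≡b))
  (𝟙-idem (v ≟ a ⊎-dec v ≟ b))

inc≢0⇒endpoint : ∀ {n} (v a b : Fin n) → inc v (a , b) ≢ 0 → v ≡ a ⊎ v ≡ b
inc≢0⇒endpoint v a b inc≢0 with v ≟ a | v ≟ b
... | yes v≡a | _       = inj₁ v≡a
... | no  _   | yes v≡b = inj₂ v≡b
... | no  _   | no  _   = contradiction refl inc≢0

-- The order on both pairs is what makes different pairs represent different edges: it excludes
-- `(a , b)` against `(b , a)`.
Distinct< : ∀ {n} → (e f : Fin n × Fin n) → Set
Distinct< (a , b) (c , d) = (a , b) ≢ (c , d) × a <ᶠ b × c <ᶠ d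

-- Distinct edges share at most one vertex, so the four possible coincidences of endpoints exclude
-- each other and their count is the indicator of adjacency.
∑-common-endpoints : ∀ {n} (e f : Fin n × Fin n) → Distinct< e f →
                     ∑[ v ∈ allFin n ] (inc v e * inc v f) ≡ 𝟙 (shareEndpoint? e f)
∑-common-endpoints e@(a , b) f@(c , d) (e≢f , a<b , c<d) = begin
  ∑[ v ∈ allFin _ ] (inc v e * inc v f)
    ≡⟨ ∑-inc e (λ v → inc v f) ⟩
  (𝟙 (a ≟ c) + 𝟙 (a ≟ d)) + (𝟙 (b ≟ c) + 𝟙 (b ≟ d))
    ≡⟨ cong₂ _+_ (𝟙-⊎ (a ≟ c) (a ≟ d) c≢d) (𝟙-⊎ (b ≟ c) (b ≟ d) c≢d) ⟨
  𝟙 (a ≟ c ⊎-dec a ≟ d) + 𝟙 (b ≟ c ⊎-dec b ≟ d)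
    ≡⟨ 𝟙-⊎ (a ≟ c ⊎-dec a ≟ d) (b ≟ c ⊎-dec b ≟ d) at-most-one ⟨
  𝟙 (shareEndpoint? e f) ∎
  where
  open ≡-Reasoning
  c≢d : ∀ {v} → ¬ (v ≡ c × v ≡ d)
  c≢d (v≡c , v≡d) = <⇒≢ c<d (trans (sym v≡c) v≡d)
  at-most-one : ¬ ((a ≡ c ⊎ a ≡ d) × (b ≡ c ⊎ b ≡ d))
  at-most-one (inj₁ refl , inj₁ refl) = <⇒≢ a<b refl
  at-most-one (inj₁ refl , inj₂ refl) = e≢f refl
  -- Here `f` would be `e` reversed, against the orientation of both.
  at-most-one (inj₂ refl , inj₁ refl) = <-asym a<b c<d
  at-most-one (inj₂ refl , inj₂ refl) = <⇒≢ a<b refl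

endpoints⇒share : ∀ {n} {v : Fin n} {a b c d} → v ≡ a ⊎ v ≡ b → v ≡ c ⊎ v ≡ d →
                  ShareEndpoint (a , b) (c , d)
endpoints⇒share (inj₁ refl) v∈f = inj₁ v∈f
endpoints⇒share (inj₂ refl) v∈f = inj₂ v∈f

-- Degree counts and the value of the denominator.

module _ {n : ℕ} (G : Graph n) where
  open Graph G

  private
    δ = minDegree G
    Δ = maxDegree G
    V = allFin n
    d = deg G
    E = edges G
    #adj = length (adjacentEdgePairs G)

    edge? : ∀ a b → Dec (a <ᶠ b × a ∼ b)
    edge? a b = (a <? b) ×-dec (a ∼? b)

    adjacent? : ∀ p → Dec (uncurry (ShareEndpoint {n}) p)
    adjacent? (e , f) = shareEndpoint? e f

  minDegree≤deg : ∀ v → δ ≤ⁿ d v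
  minDegree≤deg = Allₚ.tabulate⁻ (Allₚ.map⁻ (min≤xs n (map d V)))

  deg≤maxDegree : ∀ v → d v ≤ⁿ Δ
  deg≤maxDegree = Allₚ.tabulate⁻ (Allₚ.map⁻ (xs≤max 0 (map d V)))

  deg≤n : ∀ v → d v ≤ⁿ n
  deg≤n v = ℕₚ.≤-trans (length-filter (v ∼?_) V) (ℕₚ.≤-reflexive (length-tabulate {n = n} id))

  edges-ordered : All (λ (a , b) → a <ᶠ b) E
  edges-ordered = All.map (λ (a<b , _) → a<b) (Allₚ.all-filter (λ (a , b) → edge? a b) (cartesianProduct V V))

  pairs-distinct : All (uncurry Distinct<) (pairs E)
  pairs-distinct = pairs⁺ (AllPairs-zip edges-ordered
    (Uniqueₚ.filter⁺ (uncurry edge?) (Uniqueₚ.cartesianProduct⁺ (Uniqueₚ.allFin⁺ n) (Uniqueₚ.allFin⁺ n))))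

  -- By trichotomy an adjacency is recorded in exactly one of its two orientations; there are no
  -- loops.
  edge-orientation : ∀ v w → 𝟙 (edge? v w) + 𝟙 (edge? w v) ≡ 𝟙 (v ∼? w)
  edge-orientation v w = begin
    𝟙 (edge? v w) + 𝟙 (edge? w v)  ≡⟨ 𝟙-⊎ (edge? v w) (edge? w v) (λ ((v<w , _) , (w<v , _)) → <-asym v<w w<v) ⟨
    𝟙 (edge? v w ⊎-dec edge? w v)  ≡⟨ 𝟙-⇔ (mk⇔ [ proj₂ , ∼-sym ∘ proj₂ ]′ orient) (edge? v w ⊎-dec edge? w v) (v ∼? w) ⟩
    𝟙 (v ∼? w)                     ∎
    where
    open ≡-Reasoning
    orient : v ∼ w → (v <ᶠ w × v ∼ w) ⊎ (w <ᶠ v × w ∼ v)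
    orient v∼w with <-cmp v w
    ... | tri< v<w _ _    = inj₁ (v<w , v∼w)
    ... | tri≈ _ refl _   = contradiction v∼w ∼-irrefl
    ... | tri> _ _ w<v    = inj₂ (w<v , ∼-sym v∼w)

  -- Write the sum over all `(a , b)` weighted by `𝟙 (edge? a b)`. The indicator `𝟙 (v ≟ a)` leaves
  -- the neighbours above `v`, `𝟙 (v ≟ b)` those below, and `edge-orientation` merges them.
  deg≡∑inc : ∀ v → ∑[ e ∈ E ] inc v e ≡ d v
  deg≡∑inc v = begin
    ∑[ e ∈ E ] inc v e
      ≡⟨ ∑-filter (uncurry edge?) (cartesianProduct V V) (inc v) ⟩
    ∑[ e ∈ cartesianProduct V V ] (𝟙 (uncurry edge? e) * inc v e)
      ≡⟨ ∑-cartesianProduct V V (λ e → 𝟙 (uncurry edge? e) * inc v e) ⟩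
    ∑[ a ∈ V ] ∑[ b ∈ V ] (𝟙 (edge? a b) * inc v (a , b))
      ≡⟨ ∑-cong V (λ a → trans
           (∑-cong V (λ b → distrib (𝟙 (edge? a b)) (𝟙 (v ≟ a)) (𝟙 (v ≟ b))))
           (∑-+ V (λ b → 𝟙 (v ≟ a) * 𝟙 (edge? a b)) (λ b → 𝟙 (v ≟ b) * 𝟙 (edge? a b)))) ⟩
    ∑[ a ∈ V ] (∑[ b ∈ V ] (𝟙 (v ≟ a) * 𝟙 (edge? a b)) + ∑[ b ∈ V ] (𝟙 (v ≟ b) * 𝟙 (edge? a b)))
      ≡⟨ ∑-cong V (λ a → cong₂ _+_ (∑-*ˡ (𝟙 (v ≟ a)) V (λ b → 𝟙 (edge? a b))) (∑-δ v (λ b → 𝟙 (edge? a b)))) ⟩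
    ∑[ a ∈ V ] (𝟙 (v ≟ a) * out a + 𝟙 (edge? a v))
      ≡⟨ ∑-+ V (λ a → 𝟙 (v ≟ a) * out a) (λ a → 𝟙 (edge? a v)) ⟩
    ∑[ a ∈ V ] (𝟙 (v ≟ a) * out a) + ∑[ a ∈ V ] 𝟙 (edge? a v)
      ≡⟨ cong (_+ ∑[ a ∈ V ] 𝟙 (edge? a v)) (∑-δ v out) ⟩
    out v + ∑[ a ∈ V ] 𝟙 (edge? a v)
      ≡⟨ ∑-+ V (λ w → 𝟙 (edge? v w)) (λ w → 𝟙 (edge? w v)) ⟨
    ∑[ w ∈ V ] (𝟙 (edge? v w) + 𝟙 (edge? w v))
      ≡⟨ ∑-cong V (edge-orientation v) ⟩
    ∑[ w ∈ V ] 𝟙 (v ∼? w)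
      ≡⟨ length-filter≡∑ (v ∼?_) V ⟨
    d v ∎
    where
    open ≡-Reasoning
    out : Fin n → ℕ
    out a = ∑[ b ∈ V ] 𝟙 (edge? a b)
    distrib : ∀ x y z → x * (y + z) ≡ y * x + z * x
    distrib = solve-∀

  handshake : ∑[ v ∈ V ] d v ≡ 2 * size G
  handshake = begin
    ∑[ v ∈ V ] d v                       ≡⟨ ∑-cong V deg≡∑inc ⟨
    ∑[ v ∈ V ] ∑[ e ∈ E ] inc v e        ≡⟨ ∑-swap V E inc ⟩
    ∑[ e ∈ E ] ∑[ v ∈ V ] inc v e        ≡⟨ ∑-cong E (λ e → trans (∑-cong V (λ v → sym (ℕₚ.*-identityʳ (inc v e)))) (∑-inc e (const 1))) ⟩
    ∑[ e ∈ E ] 2                         ≡⟨ ∑-const E 2 ⟩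
    size G * 2                           ≡⟨ ℕₚ.*-comm (size G) 2 ⟩
    2 * size G                           ∎
    where open ≡-Reasoning

  common : Fin n → (Fin n × Fin n) × (Fin n × Fin n) → ℕ
  common v (e , f) = inc v e * inc v f

  -- The last sum counts the pairs of edges meeting at `v`, that is, `d v` choose 2. Kept per
  -- vertex, since the equality case needs it locally.
  deg²≡ : ∀ v → d v ^ 2 ≡ d v + 2 * ∑ (pairs E) (common v)
  deg²≡ v = begin
    d v ^ 2                                   ≡⟨ cong (d v *_) (ℕₚ.*-identityʳ (d v)) ⟩
    d v * d v                                 ≡⟨ cong₂ _*_ (deg≡∑inc v) (deg≡∑inc v) ⟨
    ∑ E (inc v) * ∑ E (inc v)                 ≡⟨ ∑-square E (inc v) ⟩
    ∑[ e ∈ E ] (inc v e * inc v e) + 2 * ∑ (pairs E) (common v)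
      ≡⟨ cong (_+ 2 * ∑ (pairs E) (common v)) (∑-cong-All (All.map (inc-idem v) edges-ordered)) ⟩
    ∑ E (inc v) + 2 * ∑ (pairs E) (common v)  ≡⟨ cong (_+ 2 * ∑ (pairs E) (common v)) (deg≡∑inc v) ⟩
    d v + 2 * ∑ (pairs E) (common v)          ∎
    where open ≡-Reasoning

  M₁≡ : M₁ G ≡ 2 * size G + 2 * #adj
  M₁≡ = begin
    M₁ G                                                  ≡⟨ ∑-cong V deg²≡ ⟩
    ∑[ v ∈ V ] (d v + 2 * ∑ (pairs E) (common v))         ≡⟨ ∑-+ V d (λ v → 2 * ∑ (pairs E) (common v)) ⟩
    ∑ V d + ∑[ v ∈ V ] (2 * ∑ (pairs E) (common v))       ≡⟨ cong₂ _+_ handshake (∑-*ˡ 2 V (λ v → ∑ (pairs E) (common v))) ⟩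
    2 * size G + 2 * ∑[ v ∈ V ] ∑ (pairs E) (common v)    ≡⟨ cong (λ t → 2 * size G + 2 * t) (∑-swap V (pairs E) common) ⟩
    2 * size G + 2 * ∑[ p ∈ pairs E ] ∑[ v ∈ V ] common v p
      -- After the interchange each pair of edges is weighted by its number of common endpoints,
      -- which is 1 or 0 according to adjacency.
      ≡⟨ cong (λ t → 2 * size G + 2 * t) (∑-cong-All (All.map (λ {p} → ∑-common-endpoints (proj₁ p) (proj₂ p)) pairs-distinct)) ⟩
    2 * size G + 2 * ∑[ p ∈ pairs E ] 𝟙 (adjacent? p)     ≡⟨ cong (λ t → 2 * size G + 2 * t) (length-filter≡∑ adjacent? (pairs E)) ⟨
    2 * size G + 2 * #adj                                 ∎
    where open ≡-Reasoning

  denominator≡ : 2 * (M₁ G ∸ 2 * size G) ≡ #adj * 4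
  denominator≡ = begin
    2 * (M₁ G ∸ 2 * size G)                      ≡⟨ cong (λ t → 2 * (t ∸ 2 * size G)) M₁≡ ⟩
    -- `M₁≡` shows `2 * size G` as a summand, so the truncated subtraction is exact.
    2 * (2 * size G + 2 * #adj ∸ 2 * size G)     ≡⟨ cong (2 *_) (ℕₚ.m+n∸m≡n (2 * size G) (2 * #adj)) ⟩
    2 * (2 * #adj)                               ≡⟨ assoc #adj ⟩
    #adj * 4                                     ∎
    where
    open ≡-Reasoning
    assoc : ∀ k → 2 * (2 * k) ≡ k * 4
    assoc = solve-∀

  -- The two bounds on `HM₂`.

  private
    edgeDegProduct : (Fin n × Fin n) × (Fin n × Fin n) → ℕ
    edgeDegProduct (e , f) = edgeDeg G e * edgeDeg G f

  -- Spreads the bound over the same list that defines `HM₂`, so the comparison becomes termwise.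
  -- The constant is the product of the two edge degrees when every endpoint has degree `k`.
  square*denominator≡∑ : ∀ k → k ^ 2 * (2 * (M₁ G ∸ 2 * size G)) ≡
                         ∑[ p ∈ adjacentEdgePairs G ] ((k + k) * (k + k))
  square*denominator≡∑ k = begin
    k ^ 2 * (2 * (M₁ G ∸ 2 * size G))    ≡⟨ cong₂ _*_ (cong (k *_) (ℕₚ.*-identityʳ k)) denominator≡ ⟩
    k * k * (#adj * 4)                   ≡⟨ rearrange k #adj ⟩
    #adj * ((k + k) * (k + k))           ≡⟨ ∑-const (adjacentEdgePairs G) _ ⟨
    ∑[ p ∈ adjacentEdgePairs G ] ((k + k) * (k + k)) ∎
    where
    open ≡-Reasoning
    rearrange : ∀ k m → k * k * (m * 4) ≡ m * ((k + k) * (k + k))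
    rearrange = solve-∀

  minDegree-product≤ : ∀ p → (δ + δ) * (δ + δ) ≤ⁿ edgeDegProduct p
  minDegree-product≤ ((a , b) , (c , e)) = ℕₚ.*-mono-≤
    (ℕₚ.+-mono-≤ (minDegree≤deg a) (minDegree≤deg b))
    (ℕₚ.+-mono-≤ (minDegree≤deg c) (minDegree≤deg e))

  ≤maxDegree-product : ∀ p → edgeDegProduct p ≤ⁿ (Δ + Δ) * (Δ + Δ)
  ≤maxDegree-product ((a , b) , (c , e)) = ℕₚ.*-mono-≤
    (ℕₚ.+-mono-≤ (deg≤maxDegree a) (deg≤maxDegree b))
    (ℕₚ.+-mono-≤ (deg≤maxDegree c) (deg≤maxDegree e))

  minDegree²*denominator≤HM₂ : δ ^ 2 * (2 * (M₁ G ∸ 2 * size G)) ≤ⁿ HM₂ G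
  minDegree²*denominator≤HM₂ = ℕₚ.≤-trans (ℕₚ.≤-reflexive (square*denominator≡∑ δ))
    (∑-mono (All.universal minDegree-product≤ (adjacentEdgePairs G)))

  HM₂≤maxDegree²*denominator : HM₂ G ≤ⁿ Δ ^ 2 * (2 * (M₁ G ∸ 2 * size G))
  HM₂≤maxDegree²*denominator = ℕₚ.≤-trans
    (∑-mono (All.universal ≤maxDegree-product (adjacentEdgePairs G)))
    (ℕₚ.≤-reflexive (sym (square*denominator≡∑ Δ)))

  -- The equality case.

  edgeDeg≥ : ∀ v e → inc v e ≢ 0 → d v + δ ≤ⁿ edgeDeg G e
  edgeDeg≥ v (a , b) inc≢0 with inc≢0⇒endpoint v a b inc≢0
  ... | inj₁ refl = ℕₚ.+-monoʳ-≤ (d v) (minDegree≤deg b)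
  ... | inj₂ refl = ℕₚ.≤-trans (ℕₚ.≤-reflexive (ℕₚ.+-comm (d v) δ)) (ℕₚ.+-monoˡ-≤ (d v) (minDegree≤deg a))

  -- If `d v` exceeds `δ`, two edges meeting at `v` would have a degree product above the minimum.
  -- So no two edges meet at `v`, and `deg²≡` collapses to `d v ^ 2 ≡ d v`.
  minDegree-tight⇒deg≤ : δ ^ 2 * (2 * (M₁ G ∸ 2 * size G)) ≡ HM₂ G →
                         ∀ v → d v ≤ⁿ δ ⊎ d v ≤ⁿ 1
  minDegree-tight⇒deg≤ eq v with d v ℕₚ.≤? δ
  ... | yes dv≤δ = inj₁ dv≤δ
  ... | no  dv≰δ = inj₂ (k²≡k⇒k≤1 (d v) (begin
    d v ^ 2                              ≡⟨ deg²≡ v ⟩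
    d v + 2 * ∑ (pairs E) (common v)     ≡⟨ cong (λ t → d v + 2 * t) (∑-cong-All (All.tabulate no-common)) ⟩
    d v + 2 * ∑ (pairs E) (const 0)      ≡⟨ cong (λ t → d v + 2 * t) (trans (∑-const (pairs E) 0) (ℕₚ.*-zeroʳ (length (pairs E)))) ⟩
    d v + 0                              ≡⟨ ℕₚ.+-identityʳ (d v) ⟩
    d v                                  ∎))
    where
    open ≡-Reasoning
    tight : All (λ p → (δ + δ) * (δ + δ) ≡ edgeDegProduct p) (adjacentEdgePairs G)
    tight = ∑-≤-tight (All.universal minDegree-product≤ (adjacentEdgePairs G))
                      (trans (sym (square*denominator≡∑ δ)) eq)
    no-common : ∀ {p} → p ∈ pairs E → common v p ≡ 0
    no-common {p@(e@(a , b) , f@(c , c′))} p∈ with common v p ℕₚ.≟ 0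
    ... | yes ≡0 = ≡0
    -- A nonzero `common v p` puts `v` on both edges, so `p` is an adjacent pair where `tight`
    -- demands equality, yet both factors are strictly larger than `δ + δ`.
    ... | no  ≢0 = contradiction (All.lookup tight (∈-filter⁺ adjacent? p∈ share)) (ℕₚ.<⇒≢ (ℕₚ.*-mono-< δ+δ<e δ+δ<f))
      where
      v∈e : inc v e ≢ 0
      v∈e eq = ≢0 (cong (_* inc v f) eq)
      v∈f : inc v f ≢ 0
      v∈f eq = ≢0 (trans (cong (inc v e *_) eq) (ℕₚ.*-zeroʳ (inc v e)))
      share : ShareEndpoint e f
      share = endpoints⇒share (inc≢0⇒endpoint v a b v∈e) (inc≢0⇒endpoint v c c′ v∈f)
      δ+δ<e : δ + δ <ⁿ edgeDeg G e
      δ+δ<e = ℕₚ.<-≤-trans (ℕₚ.+-monoˡ-< δ (ℕₚ.≰⇒> dv≰δ)) (edgeDeg≥ v e v∈e)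
      δ+δ<f : δ + δ <ⁿ edgeDeg G f
      δ+δ<f = ℕₚ.<-≤-trans (ℕₚ.+-monoˡ-< δ (ℕₚ.≰⇒> dv≰δ)) (edgeDeg≥ v f v∈f)

  deg≤1⇒denominator≡0 : (∀ v → d v ≤ⁿ 1) → 2 * (M₁ G ∸ 2 * size G) ≡ 0
  deg≤1⇒denominator≡0 d≤1 = cong (2 *_) (begin
    M₁ G ∸ 2 * size G           ≡⟨ cong (_∸ 2 * size G) (∑-cong V (λ v → k≤1⇒k²≡k (d≤1 v))) ⟩
    ∑ V d ∸ 2 * size G          ≡⟨ cong (_∸ 2 * size G) handshake ⟩
    2 * size G ∸ 2 * size G     ≡⟨ ℕₚ.n∸n≡0 (2 * size G) ⟩
    0                           ∎)
    where open ≡-Reasoning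

  minDegree-tight⇒regular : 2 * (M₁ G ∸ 2 * size G) ≢ 0 →
                            δ ^ 2 * (2 * (M₁ G ∸ 2 * size G)) ≡ HM₂ G → Regular G
  minDegree-tight⇒regular D≢0 eq u v = trans (deg≡δ u) (sym (deg≡δ v))
    where
    2≤δ : 2 ≤ⁿ δ
    -- If `δ` were at most 1, both alternatives would give `d v ≤ 1` for all `v`, so no two edges
    -- would be adjacent and the denominator would vanish.
    2≤δ = ℕₚ.≰⇒> λ δ≤1 → D≢0 (deg≤1⇒denominator≡0 λ v →
      [ (λ dv≤δ → ℕₚ.≤-trans dv≤δ δ≤1) , id ]′ (minDegree-tight⇒deg≤ eq v))
    deg≡δ : ∀ v → d v ≡ δ
    deg≡δ v = ℕₚ.≤-antisym
      ([ id , (λ dv≤1 → ℕₚ.≤-trans dv≤1 (ℕₚ.<⇒≤ 2≤δ)) ]′ (minDegree-tight⇒deg≤ eq v))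
      (minDegree≤deg v)

regular⇒minDegree≡maxDegree : ∀ {n} (G : Graph n) → Regular G → minDegree G ≡ maxDegree G
-- Without vertices both extrema return their defaults, which are then both `0`.
regular⇒minDegree≡maxDegree {zero}  G reg = refl
regular⇒minDegree≡maxDegree {suc n} G reg = ℕₚ.≤-antisym
  (ℕₚ.≤-trans (minDegree≤deg G zero) (deg≤maxDegree G zero))
  (ℕₚ.≤-trans
    (max≤v⁺ z≤n (Allₚ.map⁺ (All.universal (λ v → ℕₚ.≤-reflexive (reg v zero)) (allFin (suc n)))))
    -- The default of `min` takes part in the comparison, hence the bound `deg≤n`.
    (v≤min⁺ (deg≤n G zero) (Allₚ.map⁺ (All.universal (λ v → ℕₚ.≤-reflexive (reg zero v)) (allFin (suc n))))))

-- Imported only here, since +_ makes sections such as (c +_) ambiguous.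
open import Data.Integer using (+_; +≤+) renaming (_≤_ to _≤ᶻ_)
open import Data.Integer.Properties using (+-injective; pos-*)

-- From natural numbers to rational quotients.

-- The quotient `/` reduces to lowest terms and hides `a` and `b`; cross-multiplication is available
-- on the unnormalised fraction. Matching the denominators as successors makes `+ a / b` the image
-- of `mkℚᵘ (+ a) b-1` under `fromℚᵘ` by computation.
*≤*⇒/≤/ : ∀ a b c d .{{_ : NonZero b}} .{{_ : NonZero d}} →
          a * d ≤ⁿ c * b → + a / b ≤ + c / d
*≤*⇒/≤/ a b@(suc b-1) c d@(suc d-1) ad≤cb = ℚₚ.toℚᵘ-cancel-≤ (begin
  _              ≃⟨ ℚₚ.toℚᵘ-fromℚᵘ (mkℚᵘ (+ a) b-1) ⟩
  mkℚᵘ (+ a) b-1 ≤⟨ *≤* (subst₂ _≤ᶻ_ (pos-* a d) (pos-* c b) (+≤+ ad≤cb)) ⟩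
  mkℚᵘ (+ c) d-1 ≃⟨ ℚₚ.toℚᵘ-fromℚᵘ (mkℚᵘ (+ c) d-1) ⟨
  _              ∎)
  where open ℚᵘₚ.≤-Reasoning

/≡/⇒*≡* : ∀ a b c d .{{_ : NonZero b}} .{{_ : NonZero d}} →
          + a / b ≡ + c / d → a * d ≡ c * b
/≡/⇒*≡* a b@(suc b-1) c d@(suc d-1) eq
  with *≡* ad≡cb ← ℚₚ.fromℚᵘ-injective {mkℚᵘ (+ a) b-1} {mkℚᵘ (+ c) d-1} eq
  = +-injective (trans (pos-* a d) (trans ad≡cb (sym (pos-* c b))))

theorem6 : ∀ (n : ℕ) (G : Graph n) .{{_ : NonZero (2 * (M₁ G ∸ 2 * size G))}} →
  let δ² = + (minDegree G ^ 2) / 1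
      q  = + HM₂ G / (2 * (M₁ G ∸ 2 * size G))
      Δ² = + (maxDegree G ^ 2) / 1
  in (δ² ≤ q × q ≤ Δ²)
     × ((δ² ≡ q × q ≡ Δ²) ⇔ Regular G)
     × ((δ² ≡ q) ⇔ Regular G)
theorem6 n G = (δ²≤q , q≤Δ²)
             , mk⇔ (tight⇒regular ∘ proj₁) (λ reg → regular⇒δ²≡q reg , regular⇒q≡Δ² reg)
             , mk⇔ tight⇒regular regular⇒δ²≡q
  where
  D = 2 * (M₁ G ∸ 2 * size G)
  δ²≤q : + (minDegree G ^ 2) / 1 ≤ + HM₂ G / D
  δ²≤q = *≤*⇒/≤/ (minDegree G ^ 2) 1 (HM₂ G) D
    (ℕₚ.≤-trans (minDegree²*denominator≤HM₂ G) (ℕₚ.≤-reflexive (sym (ℕₚ.*-identityʳ (HM₂ G)))))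
  q≤Δ² : + HM₂ G / D ≤ + (maxDegree G ^ 2) / 1
  q≤Δ² = *≤*⇒/≤/ (HM₂ G) D (maxDegree G ^ 2) 1
    (ℕₚ.≤-trans (ℕₚ.≤-reflexive (ℕₚ.*-identityʳ (HM₂ G))) (HM₂≤maxDegree²*denominator G))
  tight⇒regular : + (minDegree G ^ 2) / 1 ≡ + HM₂ G / D → Regular G
  tight⇒regular eq = minDegree-tight⇒regular G (≢-nonZero⁻¹ D)
    (trans (/≡/⇒*≡* (minDegree G ^ 2) 1 (HM₂ G) D eq) (ℕₚ.*-identityʳ (HM₂ G)))
  δ²≡Δ² : Regular G → + (minDegree G ^ 2) / 1 ≡ + (maxDegree G ^ 2) / 1
  δ²≡Δ² reg = cong (λ k → + (k ^ 2) / 1) (regular⇒minDegree≡maxDegree G reg)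
  regular⇒δ²≡q : Regular G → + (minDegree G ^ 2) / 1 ≡ + HM₂ G / D
  -- For a regular graph the two bounds coincide and squeeze the quotient.
  regular⇒δ²≡q reg = ℚₚ.≤-antisym δ²≤q (ℚₚ.≤-trans q≤Δ² (ℚₚ.≤-reflexive (sym (δ²≡Δ² reg))))
  regular⇒q≡Δ² : Regular G → + HM₂ G / D ≡ + (maxDegree G ^ 2) / 1
  regular⇒q≡Δ² reg = trans (sym (regular⇒δ²≡q reg)) (δ²≡Δ² reg)
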